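{- Let $p,q\in\mathbb{N}$ with $p<q$, $q$ odd, and $\Upsilon(p,q)=2$. Let $(a_n)_{n=1}^\infty=\mathcal{G}(p/q)$. For every $m\in\mathbb{N}$, $\sum_{n=1}^m 1/a_n$ is the unique best $m$-term underapproximation of $p/q$.
   Context: $\mathbb{N}$ is the set of positive integers. For $p,q\in\mathbb{N}$, $\Upsilon(p,q)$ is the smallest positive integer $j$ such that $p$ divides $q+j$. For $\theta\in(0,1]$ let $G(\theta)=\lfloor 1/\theta\rfloor+1$. The greedy algorithm $\mathcal{G}$ produces the sequence $\mathcal{G}(\theta)=(a_n)_{n=1}^\infty$ of positive integers defined by $a_1=G(\theta)$ and $a_m=G\left(\theta-\sum_{n=1}^{m-1}1/a_n\right)$ for $m\geqslant 2$. With $(a_n)_{n=1}^\infty=\mathcal{G}(\theta)$, $\sum_{n=1}^m 1/a_n$ (which is always $<\theta$) is the best $m$-term underapproximation of $\theta$ if for all $x_1,\ldots,x_m\in\mathbb{N}$ with $\sum_{n=1}^m 1/x_n<\theta$ we have $\sum_{n=1}^m 1/x_n\leqslant\sum_{n=1}^m 1/a_n$. It is the unique best one if, in addition, for positive integers $x_1\leqslant\cdots\leqslant x_m$, $\sum_{n=1}^m 1/a_n\leqslant\sum_{n=1}^m 1/x_n<\theta$ implies $x_n=a_n$ for all $1\leqslant n\leqslant m$. -}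

module Defs where

open import Data.Nat.Base as ℕ using (ℕ; zero; suc)
import Data.Nat.Properties as ℕ
import Data.Nat.DivMod as ℕ
open import Data.Nat.Divisibility using (_∣_)
open import Data.Integer.Base as ℤ using (+_; +[1+_])
import Data.Integer.DivMod as ℤ
open import Data.Rational
import Data.Rational.Properties as ℚ
import Data.Rational.Unnormalised.Base as ℚᵘ
import Data.Rational.Unnormalised.Properties as ℚᵘ
open import Algebra.Properties.CommutativeMonoid.Sum ℚ.+-0-commutativeMonoid
open import Data.Fin.Base as Fin using (Fin; toℕ; fromℕ; inject₁)
open import Data.Fin.Properties using (toℕ-inject₁; toℕ-fromℕ)
open import Data.Product.Base using (_×_)
open import Relation.Binary.PropositionalEquality

-- Υ(p, q) = j, as a relation: j is the least positive integer with p ∣ q + j.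
Υ[_,_]≡_ : ℕ → ℕ → ℕ → Set
Υ[ p , q ]≡ j = (0 ℕ.< j) × (p ∣ q ℕ.+ j) × (∀ i → 0 ℕ.< i → p ∣ q ℕ.+ i → j ℕ.≤ i)

1/ₙ : (n : ℕ) → .{{ℕ.NonZero n}} → ℚ
1/ₙ n = + 1 / n

∑1/ : ∀ {m} (x : Fin m → ℕ) → .(∀ i → ℕ.NonZero (x i)) → ℚ
∑1/ {m} x x≢0 = ∑[ i < m ] 1/ₙ (x i) {{x≢0 i}}

-- ⌊1/θ⌋ + 1.  As ⌊1/θ⌋ ≥ 0, the absolute value only casts from ℤ to ℕ.
G : (θ : ℚ) → .{{Positive θ}} → ℕ
G θ = suc ℤ.∣ floor ((1/ θ) {{ℚ.pos⇒nonZero θ}}) ∣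

1/G<θ : ∀ θ .{{_ : Positive θ}} → 1/ₙ (G θ) < θ
1/G<θ θ@(mkℚ +[1+ n ] d _) = ℚ.toℚᵘ-cancel-<
  (ℚᵘ.<-respˡ-≃ (ℚᵘ.≃-sym (ℚ.toℚᵘ-fromℚᵘ (ℚᵘ.mkℚᵘ (+ 1) _))) (ℚᵘ.*<* (ℤ.+<+ 1+d<[1+n]*G)))
  where
  open ℕ.≤-Reasoning

  G≡ : G θ ≡ suc (suc d ℕ./ suc n)
  G≡ = cong (λ z → suc ℤ.∣ z ∣) (ℤ.div-pos-is-/ℕ (+ suc d) (suc n))

  1+d<[1+n]*G : suc (d ℕ.+ 0) ℕ.< suc n ℕ.* G θ
  1+d<[1+n]*G = begin-strict
    suc (d ℕ.+ 0)                                        ≡⟨ cong suc (ℕ.+-identityʳ d) ⟩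
    suc d                                                ≡⟨ ℕ.m≡m%n+[m/n]*n (suc d) (suc n) ⟩
    suc d ℕ.% suc n ℕ.+ (suc d ℕ./ suc n) ℕ.* suc n      <⟨ ℕ.+-monoˡ-< _ (ℕ.m%n<n (suc d) (suc n)) ⟩
    suc (suc d ℕ./ suc n) ℕ.* suc n                      ≡⟨ ℕ.*-comm _ (suc n) ⟩
    suc n ℕ.* suc (suc d ℕ./ suc n)                      ≡⟨ cong (suc n ℕ.*_) G≡ ⟨
    suc n ℕ.* G θ                                        ∎

-- Sequences are indexed from 0, so that 𝒢 θ n is the term a_{n+1}.  The
-- partial sums (∑𝒢 θ m adds the first m terms) are built along with the
-- sequence; 𝒢-rec below gives the defining recurrence with ordinary sums.
-- The restriction θ ≤ 1 is not needed for the construction.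
mutual
  𝒢 : (θ : ℚ) → .{{Positive θ}} → ℕ → ℕ
  𝒢 θ n = G (θ - ∑𝒢 θ n) {{θ-∑𝒢-pos θ n}}

  ∑𝒢 : (θ : ℚ) → .{{Positive θ}} → ℕ → ℚ
  ∑𝒢 θ zero    = 0ℚ
  ∑𝒢 θ (suc n) = ∑𝒢 θ n + 1/ₙ (𝒢 θ n)

  θ-∑𝒢-pos : ∀ θ .{{_ : Positive θ}} n → Positive (θ - ∑𝒢 θ n)
  θ-∑𝒢-pos θ zero    = positive (subst (0ℚ <_) (sym (ℚ.+-identityʳ θ)) (ℚ.positive⁻¹ θ))
  θ-∑𝒢-pos θ (suc n) = positive (begin-strict
      0ℚ                  ≡⟨ ℚ.+-inverseʳ u ⟨
      u - u               <⟨ ℚ.+-monoˡ-< (- u) (1/G<θ (θ - s) {{θ-∑𝒢-pos θ n}}) ⟩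
      (θ - s) - u         ≡⟨ ℚ.+-assoc θ (- s) (- u) ⟩
      θ + (- s - u)       ≡⟨ cong (λ t → θ + t) (ℚ.neg-distrib-+ s u) ⟨
      θ - (s + u)         ∎)
    where
    open ℚ.≤-Reasoning
    s = ∑𝒢 θ n
    u = 1/ₙ (𝒢 θ n)

𝒢-nonZero : ∀ θ .{{_ : Positive θ}} n → ℕ.NonZero (𝒢 θ n)
𝒢-nonZero θ n = _

greedySum : (θ : ℚ) → .{{Positive θ}} → ℕ → ℚ
greedySum θ m = ∑1/ {m} (λ i → 𝒢 θ (toℕ i)) (λ i → 𝒢-nonZero θ (toℕ i))

∑𝒢≡greedySum : ∀ θ .{{_ : Positive θ}} m → ∑𝒢 θ m ≡ greedySum θ m
∑𝒢≡greedySum θ zero    = refl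
∑𝒢≡greedySum θ (suc m) = begin
  ∑𝒢 θ m + u m                          ≡⟨ cong (_+ u m) (∑𝒢≡greedySum θ m) ⟩
  (∑[ i < m ] u (toℕ i)) + u m          ≡⟨ cong₂ _+_
                                              (sum-cong-≗ {m} λ i → cong u (sym (toℕ-inject₁ i)))
                                              (cong u (sym (toℕ-fromℕ m))) ⟩
  (∑[ i < m ] u (toℕ (inject₁ i))) + u (toℕ (fromℕ m))
                                        ≡⟨ sum-init-last {m} (λ i → u (toℕ i)) ⟨
  ∑[ i < suc m ] u (toℕ i)              ∎
  where
  open ≡-Reasoning
  u : ℕ → ℚ
  u n = 1/ₙ (𝒢 θ n)

θ-greedySum-pos : ∀ θ .{{_ : Positive θ}} m → Positive (θ - greedySum θ m)
θ-greedySum-pos θ m = subst (λ s → Positive (θ - s)) (∑𝒢≡greedySum θ m) (θ-∑𝒢-pos θ m)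

𝒢-rec : ∀ θ .{{_ : Positive θ}} m → 𝒢 θ m ≡ G (θ - greedySum θ m) {{θ-greedySum-pos θ m}}
𝒢-rec θ m = G-cong {{θ-∑𝒢-pos θ m}} {{θ-greedySum-pos θ m}} (cong (λ s → θ - s) (∑𝒢≡greedySum θ m))
  where
  G-cong : ∀ {r s} .{{_ : Positive r}} .{{_ : Positive s}} → r ≡ s → G r ≡ G s
  G-cong refl = refl

-- The m-th greedy partial sum is the best m-term underapproximation of θ.
-- That it is smaller than θ always holds (θ-greedySum-pos).
GreedyBest : (θ : ℚ) → .{{Positive θ}} → ℕ → Set
GreedyBest θ m =
  ∀ (x : Fin m → ℕ) (x≢0 : ∀ i → ℕ.NonZero (x i)) →
  ∑1/ x x≢0 < θ → ∑1/ x x≢0 ≤ greedySum θ m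

GreedyUniqueBest : (θ : ℚ) → .{{Positive θ}} → ℕ → Set
GreedyUniqueBest θ m =
  GreedyBest θ m ×
  (∀ (x : Fin m → ℕ) (x≢0 : ∀ i → ℕ.NonZero (x i)) →
   (∀ i j → i Fin.≤ j → x i ℕ.≤ x j) →
   greedySum θ m ≤ ∑1/ x x≢0 → ∑1/ x x≢0 < θ →
   ∀ i → x i ≡ 𝒢 θ (toℕ i))

+/-positive : ∀ p q .{{_ : ℕ.NonZero p}} .{{_ : ℕ.NonZero q}} → Positive (+ p / q)
+/-positive p q = ℚ.normalize-pos p q

{-# OPTIONS --safe #-}

-- Write p k = q + 2.  Then a₁ = k, the remainder p/q − 1/a₁ is 2/(qk) with qk odd, and from
-- then on every remainder p/q − 1/a₁ − … − 1/aₘ is the unit fraction 1/(q a₁⋯aₘ).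
-- Suppose x₁ ≤ … ≤ xₘ satisfy 1/a₁ + … + 1/aₘ ≤ 1/x₁ + … + 1/xₘ < p/q, and m ≥ 2.  The
-- difference p/q − ∑ 1/xᵢ is at least 1/(q x₁⋯xₘ), hence a₁⋯aₘ ≤ x₁⋯xₘ (for m = 1 this
-- is immediate).  On the other hand, by induction 1/x₁ + … + 1/xₖ ≤ 1/a₁ + … + 1/aₖ for
-- k < m, so summation by parts gives ∑ xᵢ/aᵢ ≤ ∑ xᵢ/xᵢ = m, and the equality case of the
-- inequality of arithmetic and geometric means forces xᵢ = aᵢ for all i.

module Submission where

open import Defs
open import Algebra.Bundles using (CommutativeRing)
open import Data.Fin.Base as Fin using (Fin; toℕ; fromℕ; inject₁; opposite)
open import Data.Fin.Properties using (toℕ-inject₁; toℕ-fromℕ; opposite-prop)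
open import Data.Fin.Relation.Unary.Top using (view; ‵fromℕ; ‵inject₁)
open import Data.Integer.Base as ℤ using (+_; +[1+_])
import Data.Integer.DivMod as ℤ
import Data.Integer.Properties as ℤ
open import Data.List.Base using (List; []; _∷_; foldr; length; map; applyDownFrom; tabulate)
open import Data.List.Properties using (length-tabulate; ∷-injective)
open import Data.List.Relation.Binary.Permutation.Propositional using (_↭_; ↭⇒↭ₛ; ↭-sym)
open import Data.List.Relation.Binary.Permutation.Propositional.Properties using (All-resp-↭; ↭-length; map⁺)
open import Data.List.Relation.Unary.All using (All; []; _∷_)
open import Data.List.Relation.Unary.All.Properties using (tabulate⁺; applyDownFrom⁺₂)
open import Data.List.Relation.Unary.AllPairs.Properties using (tabulate⁺-<)
open import Data.List.Relation.Unary.Linked as Linked using (Linked; _∷_)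
open import Data.List.Relation.Unary.Linked.Properties using (AllPairs⇒Linked)
open import Data.Nat.Base as ℕ using (ℕ; zero; suc; NonZero)
import Data.Nat.DivMod as ℕ
open import Data.Nat.Divisibility using (_∣_; divides; 1∣_; ∣m+n∣m⇒∣n; ∣n⇒∣m*n; ∣-refl)
open import Data.Nat.ListAction using (product)
open import Data.Nat.ListAction.Properties using (product≢0)
open import Data.Nat.Primality using (prime[2]; euclidsLemma)
import Data.Nat.Properties as ℕ
open import Data.Product.Base using (∃; proj₁; proj₂; _,_) renaming (_×_ to _∧_)
open import Data.Rational.Base as ℚ hiding (NonZero)
import Data.Rational.Properties as ℚ
import Data.Rational.Unnormalised.Base as ℚᵘ
import Data.Rational.Unnormalised.Properties as ℚᵘ
open import Data.Sum.Base using (inj₁; inj₂)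
open import Function.Base using (_$_; _∘_)
open import Relation.Binary.Definitions using (tri<; tri≈; tri>)
open import Relation.Binary.Properties.DecTotalOrder using (≥-decTotalOrder)
open import Relation.Binary.PropositionalEquality
open import Relation.Nullary.Decidable using (dec⇒maybe)
open import Relation.Nullary.Negation using (¬_; contradiction)
open import Tactic.RingSolver using (solve-∀)
open import Tactic.RingSolver.Core.AlmostCommutativeRing using (AlmostCommutativeRing; fromCommutativeRing)

open import Algebra.Definitions.RawSemiring +-*-rawSemiring using (_^_; _×_)
open import Algebra.Properties.CommutativeMonoid.Sum ℚ.+-0-commutativeMonoid using (sum-init-last)
open import Algebra.Properties.Monoid.Mult ℚ.+-0-monoid using (×-homo-+)
open import Algebra.Properties.Semiring.Mult (CommutativeRing.semiring ℚ.+-*-commutativeRing) using (×1-homo-*)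
open import Data.List.Relation.Binary.Permutation.Setoid.Properties ℚ.≡-setoid using (foldr-commMonoid)
open import Data.List.Sort (≥-decTotalOrder ℕ.≤-decTotalOrder) using (sort; sort-↭; sort-↗)

ring : AlmostCommutativeRing _ _
ring = fromCommutativeRing ℚ.+-*-commutativeRing (λ x → dec⇒maybe (0ℚ ℚ.≟ x))

-- Ordered-field inequalities

private variable
  a b c : ℚ

*-nonNeg : 0ℚ ≤ a → 0ℚ ≤ b → 0ℚ ≤ a * b
*-nonNeg {a} {b} a≥0 b≥0 = ℚ.nonNegative⁻¹ _
  {{ℚ.nonNeg*nonNeg⇒nonNeg a {{nonNegative a≥0}} b {{nonNegative b≥0}}}}

*-pos : 0ℚ < a → 0ℚ < b → 0ℚ < a * b
*-pos {a} {b} a>0 b>0 = ℚ.positive⁻¹ _ {{ℚ.pos*pos⇒pos a {{positive a>0}} b {{positive b>0}}}}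

+-nonNeg : 0ℚ ≤ a → 0ℚ ≤ b → 0ℚ ≤ a + b
+-nonNeg = ℚ.+-mono-≤

*-monoʳ-≤ : 0ℚ ≤ c → a ≤ b → c * a ≤ c * b
*-monoʳ-≤ {c} c≥0 = ℚ.*-monoˡ-≤-nonNeg c {{nonNegative c≥0}}

*-cancelˡ-≤ : 0ℚ < c → c * a ≤ c * b → a ≤ b
*-cancelˡ-≤ {c} c>0 = ℚ.*-cancelˡ-≤-pos c {{positive c>0}}

*-cancelˡ-≡ : 0ℚ < c → c * a ≡ c * b → a ≡ b
*-cancelˡ-≡ c>0 eq = ℚ.≤-antisym (*-cancelˡ-≤ c>0 (ℚ.≤-reflexive eq))
                                 (*-cancelˡ-≤ c>0 (ℚ.≤-reflexive (sym eq)))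

≤-by : 0ℚ ≤ c → a + c ≡ b → a ≤ b
≤-by {c} {a} c≥0 refl = ℚ.≤-trans (ℚ.≤-reflexive (sym (ℚ.+-identityʳ a))) (ℚ.+-monoʳ-≤ a c≥0)

≤⇒0≤- : a ≤ b → 0ℚ ≤ b - a
≤⇒0≤- {a} {b} a≤b = ℚ.≤-trans (ℚ.≤-reflexive (sym (ℚ.+-inverseʳ a))) (ℚ.+-monoˡ-≤ (- a) a≤b)

<⇒0<- : a < b → 0ℚ < b - a
<⇒0<- {a} {b} a<b = ℚ.≤-<-trans (ℚ.≤-reflexive (sym (ℚ.+-inverseʳ a))) (ℚ.+-monoˡ-< (- a) a<b)

0≤-⇒≤ : 0ℚ ≤ b - a → a ≤ b
0≤-⇒≤ {b} {a} h = ≤-by h (lem a b)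
  where
  lem : ∀ a b → a + (b - a) ≡ b
  lem = solve-∀ ring

square-nonNeg : ∀ a → 0ℚ ≤ a * a
square-nonNeg a with ℚ.≤-total 0ℚ a
... | inj₁ a≥0 = *-nonNeg a≥0 a≥0
... | inj₂ a≤0 = subst (0ℚ ≤_) (lem a) (*-nonNeg -a≥0 -a≥0)
  where
  -a≥0 : 0ℚ ≤ - a
  -a≥0 = ℚ.neg-antimono-≤ a≤0
  lem : ∀ a → - a * - a ≡ a * a
  lem = solve-∀ ring

square-nonPos⇒≡ : (a - b) * (a - b) ≤ 0ℚ → a ≡ b
square-nonPos⇒≡ {a} {b} h with ℚ.<-cmp a b
... | tri≈ _ a≡b _ = a≡b
... | tri> _ _ b<a = contradiction (ℚ.<-≤-trans (*-pos b-a>0 b-a>0) h) (ℚ.<-irrefl refl)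
  where b-a>0 = <⇒0<- b<a
... | tri< a<b _ _ = contradiction (ℚ.<-≤-trans (*-pos b-a>0 b-a>0) (subst (_≤ 0ℚ) (lem a b) h)) (ℚ.<-irrefl refl)
  where
  b-a>0 = <⇒0<- a<b
  lem : ∀ a b → (a - b) * (a - b) ≡ (b - a) * (b - a)
  lem = solve-∀ ring

^-pos : 0ℚ < a → ∀ n → 0ℚ < a ^ n
^-pos a>0 zero    = ℚ.positive⁻¹ 1ℚ
^-pos a>0 (suc n) = *-pos a>0 (^-pos a>0 n)

-- Division is packaged by its defining equation, so that a quotient can be taken from positivity
-- proofs alone, with no `NonZero` instance at the place of use.
∃-quotient : 0ℚ < a → 0ℚ < b → ∃ λ c → 0ℚ < c ∧ a * c ≡ b
∃-quotient {a} {b} a>0 b>0 =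
  1/ a * b ,
  *-pos {1/ a} (ℚ.positive⁻¹ (1/ a) {{ℚ.1/pos⇒pos a}}) b>0 ,
  trans (sym (ℚ.*-assoc a (1/ a) b)) (trans (cong (_* b) (ℚ.*-inverseʳ a)) (ℚ.*-identityˡ b))
  where
  instance
    _ : Positive a
    _ = positive a>0
    _ : ℚ.NonZero a
    _ = ℚ.pos⇒nonZero a

1^n≡1 : ∀ n → 1ℚ ^ n ≡ 1ℚ
1^n≡1 zero    = refl
1^n≡1 (suc n) = trans (ℚ.*-identityˡ (1ℚ ^ n)) (1^n≡1 n)

-- The embedding of ℕ in ℚ

-- As a multiple of `1ℚ`, `ι (suc n)` unfolds to `1ℚ + ι n`. The polynomial identities below rely on
-- this when they are stated with `1ℚ + n` and applied at `ι (suc n)`.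
ι : ℕ → ℚ
ι n = n × 1ℚ

ι-nonNeg : ∀ n → 0ℚ ≤ ι n
ι-nonNeg zero    = ℚ.≤-refl
ι-nonNeg (suc n) = +-nonNeg (ℚ.nonNegative⁻¹ 1ℚ) (ι-nonNeg n)

ι-pos : ∀ n .{{_ : NonZero n}} → 0ℚ < ι n
ι-pos (suc n) = ℚ.+-mono-<-≤ (ℚ.positive⁻¹ 1ℚ) (ι-nonNeg n)

ι-+ : ∀ m n → ι (m ℕ.+ n) ≡ ι m + ι n
ι-+ = ×-homo-+ 1ℚ

ι-* : ∀ m n → ι (m ℕ.* n) ≡ ι m * ι n
ι-* = ×1-homo-*

ι-mono-≤ : ∀ {m n} → m ℕ.≤ n → ι m ≤ ι n
ι-mono-≤ {n = n} ℕ.z≤n   = ι-nonNeg n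
ι-mono-≤ (ℕ.s≤s m≤n) = ℚ.+-monoʳ-≤ 1ℚ (ι-mono-≤ m≤n)

ι-mono-< : ∀ {m n} → m ℕ.< n → ι m < ι n
ι-mono-< {m} m<n = ℚ.<-≤-trans
  (subst (_< ι (suc m)) (ℚ.+-identityˡ (ι m)) (ℚ.+-monoˡ-< (ι m) (ℚ.positive⁻¹ 1ℚ)))
  (ι-mono-≤ m<n)

ι-cancel-≤ : ∀ {m n} → ι m ≤ ι n → m ℕ.≤ n
ι-cancel-≤ h = ℕ.≮⇒≥ λ n<m → ℚ.<-irrefl refl (ℚ.<-≤-trans (ι-mono-< n<m) h)

ι-cancel-< : ∀ {m n} → ι m < ι n → m ℕ.< n
ι-cancel-< h = ℕ.≰⇒> λ n≤m → ℚ.<-irrefl refl (ℚ.<-≤-trans h (ι-mono-≤ n≤m))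

ι-injective : ∀ {m n} → ι m ≡ ι n → m ≡ n
ι-injective eq = ℕ.≤-antisym (ι-cancel-≤ (ℚ.≤-reflexive eq)) (ι-cancel-≤ (ℚ.≤-reflexive (sym eq)))

-- The inequality of arithmetic and geometric means

sumℚ productℚ : List ℚ → ℚ
sumℚ     = foldr _+_ 0ℚ
productℚ = foldr _*_ 1ℚ

-- Nonnegativity of the defect is Young's inequality (n+1) α βⁿ ≤ αⁿ⁺¹ + n βⁿ⁺¹.
youngDefect : ℕ → ℚ → ℚ → ℚ
youngDefect n α β = α ^ suc n + ι n * β ^ suc n - ι (suc n) * (α * β ^ n)

-- This recursion carries the whole induction for Young's inequality: both summands are visibly
-- nonnegative, and the square in the second one settles the equality case.
youngDefect-suc : ∀ n α β →
  youngDefect (suc n) α β ≡ α * youngDefect n α β + ι (suc n) * (β ^ n) * ((α - β) * (α - β))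
youngDefect-suc n α β = lem α β (α ^ n) (β ^ n) (ι n)
  where
  lem : ∀ α β x y n →
    α * (α * x) + (1ℚ + n) * (β * (β * y)) - (1ℚ + (1ℚ + n)) * (α * (β * y)) ≡
    α * (α * x + n * (β * y) - (1ℚ + n) * (α * y)) + (1ℚ + n) * y * ((α - β) * (α - β))
  lem = solve-∀ ring

youngDefect-nonNeg : ∀ {α β} → 0ℚ < α → 0ℚ < β → ∀ n → 0ℚ ≤ youngDefect n α β
youngDefect-nonNeg {α} {β} α>0 β>0 zero = ℚ.≤-reflexive (lem α β)
  where
  lem : ∀ α β → 0ℚ ≡ α * 1ℚ + 0ℚ * (β * 1ℚ) - (1ℚ + 0ℚ) * (α * 1ℚ)
  lem = solve-∀ ring
youngDefect-nonNeg {α} {β} α>0 β>0 (suc n) = subst (0ℚ ≤_) (sym (youngDefect-suc n α β)) $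
  +-nonNeg (*-nonNeg (ℚ.<⇒≤ α>0) (youngDefect-nonNeg α>0 β>0 n))
           (*-nonNeg (*-nonNeg (ι-nonNeg (suc n)) (ℚ.<⇒≤ (^-pos β>0 n))) (square-nonNeg (α - β)))

-- Both summands in `youngDefect-suc` must vanish, and the square there has a positive coefficient.
-- The index starts at 1 because the defect of index 0 is identically zero.
youngDefect-nonPos⇒≡ : ∀ {α β} → 0ℚ < α → 0ℚ < β → ∀ n → youngDefect (suc n) α β ≤ 0ℚ → α ≡ β
youngDefect-nonPos⇒≡ {α} {β} α>0 β>0 n h = square-nonPos⇒≡ $ *-cancelˡ-≤ k>0 $ begin
  k * s                          ≤⟨ ≤-by (*-nonNeg (ℚ.<⇒≤ α>0) (youngDefect-nonNeg α>0 β>0 n)) (ℚ.+-comm (k * s) _) ⟩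
  α * youngDefect n α β + k * s  ≡⟨ youngDefect-suc n α β ⟨
  youngDefect (suc n) α β        ≤⟨ h ⟩
  0ℚ                             ≡⟨ ℚ.*-zeroʳ k ⟨
  k * 0ℚ                         ∎
  where
  open ℚ.≤-Reasoning
  s = (α - β) * (α - β)
  k = ι (suc n) * (β ^ n)
  k>0 : 0ℚ < k
  k>0 = *-pos (ι-pos (suc n)) (^-pos β>0 n)

sumℚ-pos : ∀ {t ts} → All (0ℚ <_) (t ∷ ts) → 0ℚ < sumℚ (t ∷ ts)
sumℚ-pos {t} (t>0 ∷ [])          = subst (0ℚ <_) (sym (ℚ.+-identityʳ t)) t>0
sumℚ-pos     (t>0 ∷ ts>0@(_ ∷ _)) = ℚ.+-mono-< t>0 (sumℚ-pos ts>0)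

productℚ-pos : ∀ {ts} → All (0ℚ <_) ts → 0ℚ < productℚ ts
productℚ-pos []           = ℚ.positive⁻¹ 1ℚ
productℚ-pos (t>0 ∷ ts>0) = *-pos t>0 (productℚ-pos ts>0)

-- Induction on the list: `β` is the mean of the tail, and Young's inequality for `α` and `β`
-- absorbs the head. Equality for the whole list forces equality for the tail, so both claims go
-- through one induction. A singleton is a separate case because its tail has no mean.
amgm : ∀ α ts → 0ℚ < α → All (0ℚ <_) ts → sumℚ ts ≤ ι (length ts) * α →
       productℚ ts ≤ α ^ length ts ∧ (α ^ length ts ≤ productℚ ts → All (_≡ α) ts)
amgm α []       _   _           _ = ℚ.≤-refl , λ _ → []
amgm α (t ∷ []) α>0 (t>0 ∷ []) h =
  subst₂ _≤_ (sym (ℚ.*-identityʳ t)) (sym (ℚ.*-identityʳ α)) t≤α ,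
  λ h′ → ℚ.≤-antisym t≤α (subst₂ _≤_ (ℚ.*-identityʳ α) (ℚ.*-identityʳ t) h′) ∷ []
  where
  lem : ∀ α → (1ℚ + 0ℚ) * α ≡ α
  lem = solve-∀ ring
  t≤α : t ≤ α
  t≤α = subst₂ _≤_ (ℚ.+-identityʳ t) (lem α) h
amgm α (t ∷ ts@(_ ∷ ts′)) α>0 (t>0 ∷ ts>0) h =
  0≤-⇒≤ (ℚ.≤-trans (youngDefect-nonNeg α>0 β>0 n) young≤) , equality
  where
  open ℚ.≤-Reasoning
  n = length ts
  mean = ∃-quotient (ι-pos n) (sumℚ-pos ts>0)
  β = proj₁ mean
  β>0 : 0ℚ < β
  β>0 = proj₁ (proj₂ mean)
  nβ≡ : ι n * β ≡ sumℚ ts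
  nβ≡ = proj₂ (proj₂ mean)
  ih : productℚ ts ≤ β ^ n ∧ (β ^ n ≤ productℚ ts → All (_≡ β) ts)
  ih = amgm β ts β>0 ts>0 (ℚ.≤-reflexive (sym nβ≡))
  t≤ : t ≤ ι (suc n) * α - ι n * β
  t≤ = 0≤-⇒≤ (subst (0ℚ ≤_)
    (trans (cong (λ s → ι (suc n) * α - (t + s)) (sym nβ≡)) (lem (ι (suc n) * α) t (ι n * β)))
    (≤⇒0≤- h))
    where
    lem : ∀ x y z → x - (y + z) ≡ (x - z) - y
    lem = solve-∀ ring
  lem : ∀ α n x b β → α * x - ((1ℚ + n) * α - n * β) * b ≡ α * x + n * (β * b) - (1ℚ + n) * (α * b)
  lem = solve-∀ ring
  -- The defect is `α ^ suc n` minus `(ι (suc n) * α - ι n * β) * β ^ n`. Here the bracket is at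
  -- least `t` by `t≤`, and `β ^ n` is at least the product of the tail by induction.
  young≤ : youngDefect n α β ≤ α ^ suc n - t * productℚ ts
  young≤ = begin
    youngDefect n α β                                ≡⟨ lem α (ι n) (α ^ n) (β ^ n) β ⟨
    α ^ suc n - (ι (suc n) * α - ι n * β) * β ^ n    ≤⟨ ℚ.+-monoʳ-≤ (α ^ suc n) (ℚ.neg-antimono-≤
                                                          (ℚ.*-monoʳ-≤-nonNeg (β ^ n) {{nonNegative (ℚ.<⇒≤ (^-pos β>0 n))}} t≤)) ⟩
    α ^ suc n - t * β ^ n                            ≤⟨ ℚ.+-monoʳ-≤ (α ^ suc n) (ℚ.neg-antimono-≤
                                                          (*-monoʳ-≤ (ℚ.<⇒≤ t>0) (proj₁ ih))) ⟩
    α ^ suc n - t * productℚ ts                      ∎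
  equality : α ^ suc n ≤ t * productℚ ts → All (_≡ α) (t ∷ ts)
  equality h′ = t≡α ∷ subst (λ x → All (_≡ x) ts) (sym α≡β) (proj₂ ih βⁿ≤)
    where
    α≡β : α ≡ β
    -- The tail is nonempty, so `n` is `suc (length ts′)` and the equality case of Young's
    -- inequality applies.
    α≡β = youngDefect-nonPos⇒≡ α>0 β>0 (length ts′) $ begin
      youngDefect n α β            ≤⟨ young≤ ⟩
      α ^ suc n - t * productℚ ts  ≤⟨ ℚ.+-monoˡ-≤ _ h′ ⟩
      t * productℚ ts - t * productℚ ts ≡⟨ ℚ.+-inverseʳ (t * productℚ ts) ⟩
      0ℚ                           ∎
    t≤α : t ≤ α
    t≤α = begin
      t                          ≤⟨ t≤ ⟩
      ι (suc n) * α - ι n * β    ≡⟨ cong (λ x → ι (suc n) * α - ι n * x) α≡β ⟨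
      ι (suc n) * α - ι n * α    ≡⟨ lem′ (ι n) α ⟩
      α                          ∎
      where
      lem′ : ∀ n α → (1ℚ + n) * α - n * α ≡ α
      lem′ = solve-∀ ring
    βⁿ≤ : β ^ n ≤ productℚ ts
    βⁿ≤ = *-cancelˡ-≤ α>0 $ begin
      α * β ^ n        ≡⟨ cong (λ x → α * x ^ n) α≡β ⟨
      α ^ suc n        ≤⟨ h′ ⟩
      t * productℚ ts  ≤⟨ ℚ.*-monoʳ-≤-nonNeg _ {{nonNegative (ℚ.<⇒≤ (productℚ-pos ts>0))}} t≤α ⟩
      α * productℚ ts  ∎
    t≡α : t ≡ α
    t≡α = ℚ.≤-antisym t≤α $ *-cancelˡ-≤ (^-pos α>0 n) $ begin
      α ^ n * α        ≡⟨ ℚ.*-comm (α ^ n) α ⟩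
      α ^ suc n        ≤⟨ h′ ⟩
      t * productℚ ts  ≤⟨ *-monoʳ-≤ (ℚ.<⇒≤ t>0) (proj₁ ih) ⟩
      t * β ^ n        ≡⟨ cong (λ x → t * x ^ n) α≡β ⟨
      t * α ^ n        ≡⟨ ℚ.*-comm t (α ^ n) ⟩
      α ^ n * t        ∎

-- Unit fractions

toℚᵘ-ι : ∀ n → toℚᵘ (ι n) ℚᵘ.≃ ℚᵘ.mkℚᵘ (+ n) 0
toℚᵘ-ι zero    = ℚᵘ.≃-refl
toℚᵘ-ι (suc n) = ℚᵘ.≃-trans (ℚ.toℚᵘ-homo-+ 1ℚ (ι n)) $
  ℚᵘ.≃-trans (ℚᵘ.+-congʳ (toℚᵘ 1ℚ) (toℚᵘ-ι n))
             (ℚᵘ.*≡* (cong (λ z → (+ 1 ℤ.+ z) ℤ.* + 1) (ℤ.*-identityʳ (+ n))))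

-- `_/_` reduces to lowest terms, so the computation passes to unnormalised fractions. Later
-- arguments use fractions only through this cross-multiplied form.
ι-*-/ : ∀ n d .{{_ : NonZero d}} → ι d * (+ n / d) ≡ ι n
ι-*-/ n (suc d) = ℚ.toℚᵘ-injective $ begin-equality
  toℚᵘ (ι (suc d) * (+ n / suc d))                 ≃⟨ ℚ.toℚᵘ-homo-* (ι (suc d)) (+ n / suc d) ⟩
  toℚᵘ (ι (suc d)) ℚᵘ.* toℚᵘ (+ n / suc d)         ≃⟨ ℚᵘ.*-cong (toℚᵘ-ι (suc d)) (ℚ.toℚᵘ-fromℚᵘ (ℚᵘ.mkℚᵘ (+ n) d)) ⟩
  ℚᵘ.mkℚᵘ (+ suc d) 0 ℚᵘ.* ℚᵘ.mkℚᵘ (+ n) d         ≃⟨ ℚᵘ.*≡* cross ⟩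
  ℚᵘ.mkℚᵘ (+ n) 0                                  ≃⟨ toℚᵘ-ι n ⟨
  toℚᵘ (ι n)                                       ∎
  where
  open ℚᵘ.≤-Reasoning
  cross : + suc d ℤ.* + n ℤ.* + 1 ≡ + n ℤ.* + suc (d ℕ.+ 0)
  cross = trans (ℤ.*-identityʳ _) (trans (ℤ.*-comm (+ suc d) (+ n))
                (cong (λ k → + n ℤ.* + suc k) (sym (ℕ.+-identityʳ d))))

-- The value at 0 is a default that makes reciprocals total, so that they can be mapped over a list
-- without nonzeroness proofs.
inv : ℕ → ℚ
inv zero    = 0ℚ
inv (suc n) = 1/ₙ (suc n)

ι-*-inv : ∀ n .{{_ : NonZero n}} → ι n * inv n ≡ 1ℚ
ι-*-inv (suc n) = ι-*-/ 1 (suc n)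

inv-pos : ∀ n .{{_ : NonZero n}} → 0ℚ < inv n
inv-pos (suc n) = ℚ.positive⁻¹ _ {{ℚ.normalize-pos 1 (suc n)}}

inv-injective : ∀ m n .{{_ : NonZero m}} .{{_ : NonZero n}} → ι m * inv n ≡ 1ℚ → m ≡ n
inv-injective m n eq = ι-injective $ *-cancelˡ-≡ (inv-pos n) $
  trans (ℚ.*-comm (inv n) (ι m)) (trans eq (trans (sym (ι-*-inv n)) (ℚ.*-comm (ι n) (inv n))))

∑inv : List ℕ → ℚ
∑inv xs = sumℚ (map inv xs)

-- The product of all entries serves as common denominator, reduced or not; this is the denominator
-- that `gap` compares.
∑inv-numerator : ∀ {xs} → All NonZero xs → ∃ λ M → ι (product xs) * ∑inv xs ≡ ι M
∑inv-numerator []                         = 0 , ℚ.*-zeroʳ (ι 1)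
∑inv-numerator {x ∷ xs} (x≢0 ∷ xs≢0) with ∑inv-numerator xs≢0
... | M , eq = product xs ℕ.+ x ℕ.* M , (begin
  ι (x ℕ.* product xs) * (inv x + ∑inv xs)                     ≡⟨ cong (_* (inv x + ∑inv xs)) (ι-* x (product xs)) ⟩
  ι x * ι (product xs) * (inv x + ∑inv xs)                     ≡⟨ lem (ι x) (ι (product xs)) (inv x) (∑inv xs) ⟩
  ι x * inv x * ι (product xs) + ι x * (ι (product xs) * ∑inv xs)
    ≡⟨ cong₂ (λ e m → e * ι (product xs) + ι x * m) (ι-*-inv x {{x≢0}}) eq ⟩
  1ℚ * ι (product xs) + ι x * ι M
    ≡⟨ cong₂ _+_ (ℚ.*-identityˡ (ι (product xs))) (sym (ι-* x M)) ⟩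
  ι (product xs) + ι (x ℕ.* M)                                 ≡⟨ ι-+ (product xs) (x ℕ.* M) ⟨
  ι (product xs ℕ.+ x ℕ.* M)                                   ∎)
  where
  open ≡-Reasoning
  lem : ∀ x y u v → x * y * (u + v) ≡ x * u * y + x * (y * v)
  lem = solve-∀ ring

-- A positive fraction with denominator D is at least 1/D.
gap : ∀ {θ p q xs} .{{_ : NonZero q}} → ι q * θ ≡ ι p → All NonZero xs →
      ∑inv xs < θ → 1ℚ ≤ ι (q ℕ.* product xs) * (θ - ∑inv xs)
gap {θ} {p} {q} {xs} {{q≢0}} qθ≡p xs≢0 ∑<θ =
  ≤-by (ι-nonNeg k) (sym diff≡)
  where
  open ≡-Reasoning
  Π = product xs
  M = proj₁ (∑inv-numerator xs≢0)
  lem : ∀ q Π θ s → q * Π * (θ - s) ≡ q * θ * Π - q * (Π * s)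
  lem = solve-∀ ring
  scaled : ι (q ℕ.* Π) * (θ - ∑inv xs) ≡ ι (p ℕ.* Π) - ι (q ℕ.* M)
  scaled = begin
    ι (q ℕ.* Π) * (θ - ∑inv xs)                   ≡⟨ cong (_* (θ - ∑inv xs)) (ι-* q Π) ⟩
    ι q * ι Π * (θ - ∑inv xs)                     ≡⟨ lem (ι q) (ι Π) θ (∑inv xs) ⟩
    ι q * θ * ι Π - ι q * (ι Π * ∑inv xs)         ≡⟨ cong₂ (λ x y → x * ι Π - ι q * y) qθ≡p (proj₂ (∑inv-numerator xs≢0)) ⟩
    ι p * ι Π - ι q * ι M                         ≡⟨ cong₂ _-_ (ι-* p Π) (ι-* q M) ⟨
    ι (p ℕ.* Π) - ι (q ℕ.* M)                     ∎
  qM<pΠ : q ℕ.* M ℕ.< p ℕ.* Π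
  qM<pΠ = ℕ.≰⇒> λ pΠ≤qM → ℚ.<-irrefl refl $ ℚ.<-≤-trans
    (subst (0ℚ <_) scaled (*-pos (ι-pos (q ℕ.* Π) {{ℕ.m*n≢0 q Π {{q≢0}} {{product≢0 xs≢0}}}}) (<⇒0<- ∑<θ)))
    (subst (ι (p ℕ.* Π) - ι (q ℕ.* M) ≤_) (ℚ.+-inverseʳ (ι (q ℕ.* M))) (ℚ.+-monoˡ-≤ (- ι (q ℕ.* M)) (ι-mono-≤ pΠ≤qM)))
  -- The scaled difference is a positive integer; `k` is its excess over 1.
  k = proj₁ (ℕ.m≤n⇒∃[o]m+o≡n qM<pΠ)
  lem′ : ∀ m k → 1ℚ + (m + k) - m ≡ 1ℚ + k
  lem′ = solve-∀ ring
  diff≡ : ι (q ℕ.* Π) * (θ - ∑inv xs) ≡ 1ℚ + ι k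
  diff≡ = begin
    ι (q ℕ.* Π) * (θ - ∑inv xs)             ≡⟨ scaled ⟩
    ι (p ℕ.* Π) - ι (q ℕ.* M)               ≡⟨ cong (λ m → ι m - ι (q ℕ.* M)) (proj₂ (ℕ.m≤n⇒∃[o]m+o≡n qM<pΠ)) ⟨
    1ℚ + ι (q ℕ.* M ℕ.+ k) - ι (q ℕ.* M)    ≡⟨ cong (λ m → 1ℚ + m - ι (q ℕ.* M)) (ι-+ (q ℕ.* M) k) ⟩
    1ℚ + (ι (q ℕ.* M) + ι k) - ι (q ℕ.* M)  ≡⟨ lem′ (ι (q ℕ.* M)) (ι k) ⟩
    1ℚ + ι k                                ∎

-- Comparison with a reference sequence by summation by parts

-- A finite sequence x₁ ≤ … ≤ x_k is represented by the list x_k ∷ … ∷ x₁, so that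
-- its initial segments are the tails of the list.

module Comparison (a : ℕ → ℕ) (a≢0 : ∀ n → NonZero (a n)) where

  initial : ℕ → List ℕ
  initial = applyDownFrom a

  -- The quotients xᵢ/aᵢ. Since the list starts with the last term, the 0-based index of an entry is
  -- the length of the tail after it.
  ratios : List ℕ → List ℚ
  ratios []       = []
  ratios (x ∷ xs) = ι x * inv (a (length xs)) ∷ ratios xs

  length-ratios : ∀ xs → length (ratios xs) ≡ length xs
  length-ratios []       = refl
  length-ratios (x ∷ xs) = cong suc (length-ratios xs)

  ratios-pos : ∀ {xs} → All NonZero xs → All (0ℚ <_) (ratios xs)
  ratios-pos []                     = []
  ratios-pos {x ∷ xs} (x≢0 ∷ xs≢0) =
    *-pos (ι-pos x {{x≢0}}) (inv-pos (a (length xs)) {{a≢0 _}}) ∷ ratios-pos xs≢0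

  productℚ-ratios : ∀ xs → ι (product (initial (length xs))) * productℚ (ratios xs) ≡ ι (product xs)
  productℚ-ratios []       = ℚ.*-identityʳ (ι 1)
  productℚ-ratios (x ∷ xs) = begin
    ι (A ℕ.* Π) * (ι x * inv A * R)        ≡⟨ cong (_* (ι x * inv A * R)) (ι-* A Π) ⟩
    ι A * ι Π * (ι x * inv A * R)          ≡⟨ lem (ι A) (ι Π) (ι x) (inv A) R ⟩
    ι A * inv A * (ι x * (ι Π * R))        ≡⟨ cong₂ _*_ (ι-*-inv A {{a≢0 _}}) (cong (ι x *_) (productℚ-ratios xs)) ⟩
    1ℚ * (ι x * ι (product xs))            ≡⟨ ℚ.*-identityˡ _ ⟩
    ι x * ι (product xs)                   ≡⟨ ι-* x (product xs) ⟨
    ι (x ℕ.* product xs)                   ∎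
    where
    open ≡-Reasoning
    A = a (length xs)
    Π = product (initial (length xs))
    R = productℚ (ratios xs)
    lem : ∀ a p x v r → a * p * (x * v * r) ≡ a * v * (x * (p * r))
    lem = solve-∀ ring

  ratios≡1 : ∀ {xs} → All NonZero xs → All (_≡ 1ℚ) (ratios xs) → xs ≡ initial (length xs)
  ratios≡1 []                     []         = refl
  ratios≡1 {x ∷ xs} (x≢0 ∷ xs≢0) (eq ∷ eqs) =
    cong₂ _∷_ (inv-injective x (a (length xs)) {{x≢0}} {{a≢0 _}} eq) (ratios≡1 xs≢0 eqs)

  deficit : List ℕ → ℚ
  deficit xs = ∑inv (initial (length xs)) - ∑inv xs

  -- The inductive step of a summation by parts; between two steps the coefficient of the
  -- (nonnegative) deficit is raised from one xᵢ to the next.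
  ratios-step : ∀ {x} xs .{{_ : NonZero x}} →
    sumℚ (ratios xs) ≤ ι (length xs) + ι x * deficit xs →
    sumℚ (ratios (x ∷ xs)) ≤ ι (suc (length xs)) + ι x * deficit (x ∷ xs)
  ratios-step {x} xs h = begin
    X * u + sumℚ (ratios xs)                 ≤⟨ ℚ.+-monoʳ-≤ (X * u) h ⟩
    X * u + (n + X * (S - Σ))                ≡⟨ lem X u v n S Σ ⟩
    (X * v + n) + X * ((u + S) - (v + Σ))    ≡⟨ cong (λ e → (e + n) + X * ((u + S) - (v + Σ))) (ι-*-inv x) ⟩
    (1ℚ + n) + X * ((u + S) - (v + Σ))       ∎
    where
    open ℚ.≤-Reasoning
    X = ι x
    u = inv (a (length xs))
    v = inv x
    n = ι (length xs)
    S = ∑inv (initial (length xs))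
    Σ = ∑inv xs
    lem : ∀ X u v n S Σ → X * u + (n + X * (S - Σ)) ≡ (X * v + n) + X * ((u + S) - (v + Σ))
    lem = solve-∀ ring

  module _ {θ : ℚ}
    (product-≥ : ∀ xs → All NonZero xs → ∑inv xs < θ → ∑inv (initial (length xs)) ≤ ∑inv xs →
                 product (initial (length xs)) ℕ.≤ product xs)
    where

    -- The three claims support each other. The third, for the tail and with `y` the next entry,
    -- bounds the sum of the ratios; AM-GM then gives the second, and the second gives the first.
    -- The first makes the deficit nonnegative, which allows the coefficient in the third to be
    -- raised to any admissible `y`.
    BestWithAbelBound : List ℕ → Set
    BestWithAbelBound xs =
      ∑inv xs ≤ ∑inv (initial (length xs)) ∧
      (∑inv (initial (length xs)) ≤ ∑inv xs → xs ≡ initial (length xs)) ∧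
      (∀ y → Linked ℕ._≥_ (y ∷ xs) → sumℚ (ratios xs) ≤ ι (length xs) + ι y * deficit xs)

    best : ∀ xs → All NonZero xs → Linked ℕ._≥_ xs → ∑inv xs < θ → BestWithAbelBound xs
    best []           _             _  _   = ℚ.≤-refl , (λ _ → refl) , λ y _ → ≤-by ℚ.≤-refl (lem (ι y))
      where
      lem : ∀ y → 0ℚ + 0ℚ ≡ 0ℚ + y * (0ℚ - 0ℚ)
      lem = solve-∀ ring
    best xxs@(x ∷ xs) xxs≢0@(x≢0 ∷ xs≢0) ↘ ∑<θ = ∑≤ , unique , bound
      where
      open ℚ.≤-Reasoning
      S = ∑inv (initial (length xxs))
      ∑xs<θ : ∑inv xs < θ
      ∑xs<θ = ℚ.≤-<-trans (≤-by (ℚ.<⇒≤ (inv-pos x {{x≢0}})) (ℚ.+-comm (∑inv xs) (inv x))) ∑<θ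
      bound-x : sumℚ (ratios xxs) ≤ ι (length xxs) + ι x * deficit xxs
      bound-x = ratios-step xs {{x≢0}} (proj₂ (proj₂ (best xs xs≢0 (Linked.tail ↘) ∑xs<θ)) x ↘)
      unique : S ≤ ∑inv xxs → xxs ≡ initial (length xxs)
      -- The ratios have mean at most 1 by `sum≤` and product at least 1 by `Π≤`, so AM-GM with `α`
      -- equal to 1 holds with equality.
      unique S≤∑ = ratios≡1 xxs≢0 $ proj₂ amgm-ratios $ begin
        1ℚ ^ length (ratios xxs)  ≡⟨ 1^n≡1 (length (ratios xxs)) ⟩
        1ℚ                        ≤⟨ *-cancelˡ-≤ (ι-pos Π {{Π≢0}}) Π≤ ⟩
        productℚ (ratios xxs)     ∎
        where
        Π = product (initial (length xxs))
        Π≢0 : NonZero Π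
        Π≢0 = product≢0 (applyDownFrom⁺₂ a (length xxs) a≢0)
        Π≤ : ι Π * 1ℚ ≤ ι Π * productℚ (ratios xxs)
        Π≤ = begin
          ι Π * 1ℚ                     ≡⟨ ℚ.*-identityʳ (ι Π) ⟩
          ι Π                          ≤⟨ ι-mono-≤ (product-≥ xxs xxs≢0 ∑<θ S≤∑) ⟩
          ι (product xxs)              ≡⟨ productℚ-ratios xxs ⟨
          ι Π * productℚ (ratios xxs)  ∎
        lem : ∀ n x s σ → n + x * (s - σ) + x * (σ - s) ≡ n * 1ℚ
        lem = solve-∀ ring
        sum≤ : sumℚ (ratios xxs) ≤ ι (length (ratios xxs)) * 1ℚ
        sum≤ = begin
          sumℚ (ratios xxs)                   ≤⟨ bound-x ⟩
          ι (length xxs) + ι x * deficit xxs  ≤⟨ ≤-by (*-nonNeg (ι-nonNeg x) (≤⇒0≤- S≤∑)) (lem (ι (length xxs)) (ι x) S (∑inv xxs)) ⟩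
          ι (length xxs) * 1ℚ                 ≡⟨ cong (λ n → ι n * 1ℚ) (length-ratios xxs) ⟨
          ι (length (ratios xxs)) * 1ℚ        ∎
        amgm-ratios = amgm 1ℚ (ratios xxs) (ℚ.positive⁻¹ 1ℚ) (ratios-pos xxs≢0) sum≤
      ∑≤ : ∑inv xxs ≤ S
      -- If the sum is at least `S`, uniqueness already identifies the two lists.
      ∑≤ with ℚ.≤-total (∑inv xxs) S
      ... | inj₁ ∑≤S = ∑≤S
      ... | inj₂ S≤∑ = ℚ.≤-reflexive (cong ∑inv (unique S≤∑))
      bound : ∀ y → Linked ℕ._≥_ (y ∷ xxs) → sumℚ (ratios xxs) ≤ ι (length xxs) + ι y * deficit xxs
      bound y (x≤y ∷ _) = ℚ.≤-trans bound-x $ ℚ.+-monoʳ-≤ (ι (length xxs)) $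
        ℚ.*-monoʳ-≤-nonNeg (deficit xxs) {{nonNegative (≤⇒0≤- ∑≤)}} (ι-mono-≤ x≤y)

-- The greedy algorithm

-- The hypotheses say that θ is c/D with cg ≤ D < c(g + 1), so ⌊1/θ⌋ is g. The fraction c/D may be
-- unreduced; `DN≡cM` relates it to the reduced form N/M on which `G` computes.
G-≡ : ∀ θ .{{_ : Positive θ}} {D c r} g → ι D * θ ≡ ι c →
      c ℕ.* suc g ≡ D ℕ.+ r → 0 ℕ.< r → r ℕ.≤ c → G θ ≡ suc g
G-≡ θ@(mkℚ +[1+ n ] d _) {D} {c} {r} g Dθ≡c c[1+g]≡D+r 0<r r≤c =
  cong suc (trans (cong ℤ.∣_∣ (ℤ.div-pos-is-/ℕ (+ suc d) (suc n))) M/N≡g)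
  where
  open ℕ.≤-Reasoning
  M = suc d
  N = suc n
  Mθ≡N : ι M * θ ≡ ι N
  Mθ≡N = trans (cong (ι M *_) (sym (ℚ.↥p/↧p≡p θ))) (ι-*-/ N M)
  lem : ∀ D M θ → D * (M * θ) ≡ M * (D * θ)
  lem = solve-∀ ring
  DN≡cM : D ℕ.* N ≡ c ℕ.* M
  DN≡cM = ι-injective (trans (ι-* D N) (trans (cong (ι D *_) (sym Mθ≡N)) (trans (lem (ι D) (ι M) θ)
    (trans (cong (ι M *_) Dθ≡c) (trans (ℚ.*-comm (ι M) (ι c)) (sym (ι-* c M)))))))
  instance
    c≢0 : NonZero c
    c≢0 = ℕ.>-nonZero (ℕ.<-≤-trans 0<r r≤c)
  cg≤D : c ℕ.* g ℕ.≤ D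
  cg≤D = ℕ.+-cancelˡ-≤ c _ _ (begin
    c ℕ.+ c ℕ.* g  ≡⟨ ℕ.*-suc c g ⟨
    c ℕ.* suc g    ≡⟨ c[1+g]≡D+r ⟩
    D ℕ.+ r        ≤⟨ ℕ.+-monoʳ-≤ D r≤c ⟩
    D ℕ.+ c        ≡⟨ ℕ.+-comm D c ⟩
    c ℕ.+ D        ∎)
  gN≤M : g ℕ.* N ℕ.≤ M
  gN≤M = ℕ.*-cancelˡ-≤ c (begin
    c ℕ.* (g ℕ.* N)  ≡⟨ ℕ.*-assoc c g N ⟨
    c ℕ.* g ℕ.* N    ≤⟨ ℕ.*-monoˡ-≤ N cg≤D ⟩
    D ℕ.* N          ≡⟨ DN≡cM ⟩
    c ℕ.* M          ∎)
  M<[1+g]N : M ℕ.< suc g ℕ.* N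
  M<[1+g]N = ℕ.*-cancelˡ-< c _ _ (begin-strict
    c ℕ.* M              ≡⟨ DN≡cM ⟨
    D ℕ.* N              <⟨ ℕ.*-monoˡ-< N (ℕ.m<m+n D 0<r) ⟩
    (D ℕ.+ r) ℕ.* N      ≡⟨ cong (ℕ._* N) c[1+g]≡D+r ⟨
    c ℕ.* suc g ℕ.* N    ≡⟨ ℕ.*-assoc c (suc g) N ⟩
    c ℕ.* (suc g ℕ.* N)  ∎)
  M/N≡g : M ℕ./ N ≡ g
  M/N≡g = ℕ.≤-antisym (ℕ.≤-pred (ℕ.m<n*o⇒m/o<n M<[1+g]N))
    (subst (ℕ._≤ M ℕ./ N) (ℕ.m*n/n≡m g N) (ℕ./-monoˡ-≤ N gN≤M))

∑inv-𝒢 : ∀ θ .{{_ : Positive θ}} n → ∑inv (applyDownFrom (𝒢 θ) n) ≡ ∑𝒢 θ n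
∑inv-𝒢 θ zero    = refl
∑inv-𝒢 θ (suc n) = trans (cong (λ s → inv (𝒢 θ n) + s) (∑inv-𝒢 θ n)) (ℚ.+-comm (inv (𝒢 θ n)) (∑𝒢 θ n))

remainder : ℚ → (ℕ → ℕ) → ℕ → ℚ
remainder θ a n = θ - ∑inv (applyDownFrom a n)

-- Stated for an abstract sequence, because 𝒢 would be unfolded at its first terms.
record IsGreedy (θ : ℚ) (a : ℕ → ℕ) : Set where
  field
    remainder-pos : ∀ n → 0ℚ < remainder θ a n
    term-≡        : ∀ n D c r g → ι D * remainder θ a n ≡ ι c →
                    c ℕ.* suc g ≡ D ℕ.+ r → 0 ℕ.< r → r ℕ.≤ c → a n ≡ suc g

𝒢-isGreedy : ∀ θ .{{_ : Positive θ}} → IsGreedy θ (𝒢 θ)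
𝒢-isGreedy θ = record
  { remainder-pos = λ n → subst (λ s → 0ℚ < θ - s) (sym (∑inv-𝒢 θ n)) (ℚ.positive⁻¹ _ {{θ-∑𝒢-pos θ n}})
  ; term-≡        = λ n D c r g DR≡c → G-≡ (θ - ∑𝒢 θ n) {{θ-∑𝒢-pos θ n}} g
                      (subst (λ s → ι D * (θ - s) ≡ _) (∑inv-𝒢 θ n) DR≡c)
  }

-- c/D − 1/g = (cg − D)/(Dg)
remainder-step : ∀ θ a n D c r {g} → ι D * remainder θ a n ≡ ι c →
  c ℕ.* suc g ≡ D ℕ.+ r → a n ≡ suc g → ι (D ℕ.* a n) * remainder θ a (suc n) ≡ ι r
remainder-step θ a n D c r {g} DR≡c cg≡D+r aₙ≡1+g = begin
  ι (D ℕ.* a n) * (θ - (v + S))           ≡⟨ cong (_* (θ - (v + S))) (ι-* D (a n)) ⟩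
  ι D * ι (a n) * (θ - (v + S))           ≡⟨ lem (ι D) (ι (a n)) θ S v ⟩
  ι D * (θ - S) * ι (a n) - ι D * (ι (a n) * v)
    ≡⟨ cong₂ (λ x y → x * ι (a n) - ι D * y) DR≡c (ι-*-inv (a n) {{subst NonZero (sym aₙ≡1+g) _}}) ⟩
  ι c * ι (a n) - ι D * 1ℚ                ≡⟨ cong (_- ι D * 1ℚ) (ι-* c (a n)) ⟨
  ι (c ℕ.* a n) - ι D * 1ℚ                ≡⟨ cong (λ k → ι k - ι D * 1ℚ) (trans (cong (c ℕ.*_) aₙ≡1+g) cg≡D+r) ⟩
  ι (D ℕ.+ r) - ι D * 1ℚ                  ≡⟨ cong (_- ι D * 1ℚ) (ι-+ D r) ⟩
  ι D + ι r - ι D * 1ℚ                    ≡⟨ lem′ (ι D) (ι r) ⟩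
  ι r                                     ∎
  where
  open ≡-Reasoning
  v = inv (a n)
  S = ∑inv (applyDownFrom a n)
  lem : ∀ D a θ S v → D * a * (θ - (v + S)) ≡ D * (θ - S) * a - D * (a * v)
  lem = solve-∀ ring
  lem′ : ∀ D r → D + r - D * 1ℚ ≡ r
  lem′ = solve-∀ ring

-- Greedy remainders of p/q when q + 2 is a multiple of p and q is odd

odd⇒≡1+2j : ∀ {n} → ¬ (2 ∣ n) → ∃ λ j → n ≡ suc (j ℕ.* 2)
odd⇒≡1+2j {n} 2∤n with n ℕ.% 2 | ℕ.m≡m%n+[m/n]*n n 2 | ℕ.m%n<n n 2
... | 0 | eq | _ = contradiction (divides (n ℕ./ 2) eq) 2∤n
... | 1 | eq | _ = n ℕ./ 2 , eq
... | suc (suc _) | _ | ℕ.s≤s (ℕ.s≤s ())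

module _ {θ : ℚ} {a : ℕ → ℕ} (greedy : IsGreedy θ a) {p q k : ℕ} .{{q≢0 : NonZero q}}
  (qθ≡p : ι q * θ ≡ ι p) (q+2≡pk : q ℕ.+ 2 ≡ p ℕ.* k) (2≤p : 2 ℕ.≤ p) (2∤q : ¬ (2 ∣ q))
  where

  open IsGreedy greedy

  private
    R : ℕ → ℚ
    R = remainder θ a
    Π : ℕ → ℕ
    Π n = product (applyDownFrom a n)

    k≢0 : k ≢ 0
    k≢0 k≡0 with () ← trans (ℕ.+-comm 2 q) (trans q+2≡pk (trans (cong (p ℕ.*_) k≡0) (ℕ.*-zeroʳ p)))

    k≡1+ : k ≡ suc (ℕ.pred k)
    k≡1+ = sym (ℕ.suc-pred k {{ℕ.≢-nonZero k≢0}})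

    -- If k were even, then q + 2 = pk would be even, and with it q.
    2∤qk : ¬ (2 ∣ q ℕ.* k)
    2∤qk 2∣qk with euclidsLemma q k prime[2] 2∣qk
    ... | inj₁ 2∣q = 2∤q 2∣q
    ... | inj₂ 2∣k = 2∤q (∣m+n∣m⇒∣n (subst (2 ∣_) (trans (sym q+2≡pk) (ℕ.+-comm q 2)) (∣n⇒∣m*n p 2∣k)) ∣-refl)

    remainder₀ : ι q * R 0 ≡ ι p
    remainder₀ = trans (cong (λ s → ι q * s) (ℚ.+-identityʳ θ)) qθ≡p

    p[1+g]≡q+2 : p ℕ.* suc (ℕ.pred k) ≡ q ℕ.+ 2
    p[1+g]≡q+2 = trans (cong (p ℕ.*_) (sym k≡1+)) (sym q+2≡pk)

    a₀≡k : a 0 ≡ k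
    a₀≡k = trans (term-≡ 0 q p 2 (ℕ.pred k) remainder₀ p[1+g]≡q+2 (ℕ.s≤s ℕ.z≤n) 2≤p) (sym k≡1+)

    remainder₁ : ι (q ℕ.* k) * R 1 ≡ ι 2
    remainder₁ = subst (λ x → ι (q ℕ.* x) * R 1 ≡ ι 2) a₀≡k
      (remainder-step θ a 0 q p 2 remainder₀ p[1+g]≡q+2 (trans a₀≡k k≡1+))

    -- With qk = 1 + 2j, the remainder 2/(qk) is followed by the term 1 + j, and the new numerator
    -- is 2(1 + j) - qk = 1. After that, 1/D is followed by the term D + 1 and leaves 1/(D(D + 1)).
    -- Thus the denominator is exactly q times the product of the terms.
    remainder₂₊ : ∀ n → ι (q ℕ.* Π (2 ℕ.+ n)) * R (2 ℕ.+ n) ≡ ι 1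
    remainder₂₊ zero with odd⇒≡1+2j 2∤qk
    ... | j , qk≡1+2j = subst (λ D → ι D * R 2 ≡ ι 1) D≡
      (remainder-step θ a 1 (q ℕ.* k) 2 1 remainder₁ 2[1+j]≡qk+1
        (term-≡ 1 (q ℕ.* k) 2 1 j remainder₁ 2[1+j]≡qk+1 (ℕ.s≤s ℕ.z≤n) (ℕ.s≤s ℕ.z≤n)))
      where
      open ≡-Reasoning
      2[1+j]≡qk+1 : 2 ℕ.* suc j ≡ q ℕ.* k ℕ.+ 1
      2[1+j]≡qk+1 = begin
        2 ℕ.* suc j          ≡⟨ ℕ.*-comm 2 (suc j) ⟩
        suc (suc (j ℕ.* 2))  ≡⟨ cong suc qk≡1+2j ⟨
        suc (q ℕ.* k)        ≡⟨ ℕ.+-comm 1 _ ⟩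
        q ℕ.* k ℕ.+ 1        ∎
      D≡ : q ℕ.* k ℕ.* a 1 ≡ q ℕ.* (a 1 ℕ.* (a 0 ℕ.* 1))
      D≡ = begin
        q ℕ.* k ℕ.* a 1             ≡⟨ ℕ.*-assoc q k (a 1) ⟩
        q ℕ.* (k ℕ.* a 1)           ≡⟨ cong (q ℕ.*_) (ℕ.*-comm k (a 1)) ⟩
        q ℕ.* (a 1 ℕ.* k)           ≡⟨ cong (λ x → q ℕ.* (a 1 ℕ.* x)) (trans (ℕ.*-identityʳ (a 0)) a₀≡k) ⟨
        q ℕ.* (a 1 ℕ.* (a 0 ℕ.* 1)) ∎
    remainder₂₊ (suc n) = subst (λ D → ι D * R (3 ℕ.+ n) ≡ ι 1) D≡
      (remainder-step θ a (2 ℕ.+ n) D 1 1 (remainder₂₊ n) 1+D≡D+1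
        (term-≡ (2 ℕ.+ n) D 1 1 D (remainder₂₊ n) 1+D≡D+1 (ℕ.s≤s ℕ.z≤n) (ℕ.s≤s ℕ.z≤n)))
      where
      D = q ℕ.* Π (2 ℕ.+ n)
      1+D≡D+1 : 1 ℕ.* suc D ≡ D ℕ.+ 1
      1+D≡D+1 = trans (ℕ.*-identityˡ (suc D)) (ℕ.+-comm 1 D)
      D≡ : D ℕ.* a (2 ℕ.+ n) ≡ q ℕ.* Π (3 ℕ.+ n)
      D≡ = trans (ℕ.*-assoc q (Π (2 ℕ.+ n)) _) (cong (q ℕ.*_) (ℕ.*-comm (Π (2 ℕ.+ n)) _))

  greedy-product-≤ : ∀ xs → All NonZero xs → ∑inv xs < θ → ∑inv (applyDownFrom a (length xs)) ≤ ∑inv xs →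
                     Π (length xs) ℕ.≤ product xs
  greedy-product-≤ []       _           _   _ = ℕ.≤-refl
  -- After one term the remainder is 2/(qk), and comparing it with the gap would only give k ≤ 2x.
  -- Instead, q < px and 2 ≤ p give pk = q + 2 < p(x + 1).
  greedy-product-≤ (x ∷ []) (x≢0 ∷ []) ∑<θ _ = ℕ.*-monoˡ-≤ 1 (subst (ℕ._≤ x) (sym a₀≡k) k≤x)
    where
    v = inv x
    q<px : q ℕ.< p ℕ.* x
    q<px = ι-cancel-< (begin-strict
      ι q                  ≡⟨ lem₁ (ι q) ⟨
      ι q * 1ℚ             ≡⟨ cong (λ e → ι q * e) (ι-*-inv x {{x≢0}}) ⟨
      ι q * (ι x * v)      ≡⟨ lem₂ (ι q) (ι x) v ⟩
      ι q * ι x * (v + 0ℚ) <⟨ ℚ.*-monoʳ-<-pos (ι q * ι x) {{positive (*-pos (ι-pos q) (ι-pos x {{x≢0}}))}} ∑<θ ⟩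
      ι q * ι x * θ        ≡⟨ lem₃ (ι q) (ι x) θ ⟩
      ι q * θ * ι x        ≡⟨ cong (_* ι x) qθ≡p ⟩
      ι p * ι x            ≡⟨ ι-* p x ⟨
      ι (p ℕ.* x)          ∎)
      where
      open ℚ.≤-Reasoning
      lem₁ : ∀ q → q * 1ℚ ≡ q
      lem₁ = solve-∀ ring
      lem₂ : ∀ q x v → q * (x * v) ≡ q * x * (v + 0ℚ)
      lem₂ = solve-∀ ring
      lem₃ : ∀ q x θ → q * x * θ ≡ q * θ * x
      lem₃ = solve-∀ ring
    k≤x : k ℕ.≤ x
    k≤x = ℕ.≤-pred (ℕ.*-cancelˡ-< p _ _ (begin-strict
      p ℕ.* k        ≡⟨ q+2≡pk ⟨
      q ℕ.+ 2        <⟨ ℕ.+-mono-<-≤ q<px 2≤p ⟩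
      p ℕ.* x ℕ.+ p  ≡⟨ ℕ.+-comm (p ℕ.* x) p ⟩
      p ℕ.+ p ℕ.* x  ≡⟨ ℕ.*-suc p x ⟨
      p ℕ.* suc x    ∎))
      where open ℕ.≤-Reasoning
  -- From two terms on, the greedy remainder equals the reciprocal of q times the product of its
  -- terms, while the remainder left by `xs` is at least the corresponding reciprocal and, by `S≤∑`,
  -- at most the greedy one.
  greedy-product-≤ xs@(_ ∷ _ ∷ xs′) xs≢0 ∑<θ S≤∑ =
    ℕ.*-cancelˡ-≤ q (ι-cancel-≤ (*-cancelˡ-≤ (remainder-pos n) (begin
      R n * ι (q ℕ.* Π n)                   ≡⟨ ℚ.*-comm (R n) (ι (q ℕ.* Π n)) ⟩
      ι (q ℕ.* Π n) * R n                   ≡⟨ remainder₂₊ (length xs′) ⟩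
      1ℚ                                    ≤⟨ gap {p = p} qθ≡p xs≢0 ∑<θ ⟩
      ι (q ℕ.* product xs) * (θ - ∑inv xs)  ≤⟨ *-monoʳ-≤ (ι-nonNeg (q ℕ.* product xs))
                                                 (ℚ.+-monoʳ-≤ θ (ℚ.neg-antimono-≤ S≤∑)) ⟩
      ι (q ℕ.* product xs) * R n            ≡⟨ ℚ.*-comm (ι (q ℕ.* product xs)) (R n) ⟩
      R n * ι (q ℕ.* product xs)            ∎)))
    where
    open ℚ.≤-Reasoning
    n = length xs

-- Finite sequences as lists

descending : ∀ {m} → (Fin m → ℕ) → List ℕ
descending x = tabulate (x ∘ opposite)

1/ₙ≡inv : ∀ n .{{_ : NonZero n}} → 1/ₙ n ≡ inv n
1/ₙ≡inv (suc n) = refl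

-- The induction removes the last index: the head of `descending x` computes to `x (fromℕ m)` and
-- its tail to `descending (x ∘ inject₁)`, which matches `sum-init-last`.
∑inv-descending : ∀ {m} (x : Fin m → ℕ) .(x≢0 : ∀ i → NonZero (x i)) →
                  ∑1/ x x≢0 ≡ ∑inv (descending x)
∑inv-descending {zero}  x x≢0 = refl
∑inv-descending {suc m} x x≢0 = begin
  ∑1/ x x≢0                                                ≡⟨ sum-init-last {m} (λ i → 1/ₙ (x i) {{x≢0 i}}) ⟩
  ∑1/ (x ∘ inject₁) (x≢0 ∘ inject₁) + 1/ₙ (x (fromℕ m)) {{x≢0 (fromℕ m)}}
    ≡⟨ cong₂ _+_ (∑inv-descending (x ∘ inject₁) (x≢0 ∘ inject₁)) (1/ₙ≡inv (x (fromℕ m)) {{x≢0 (fromℕ m)}}) ⟩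
  ∑inv (descending (x ∘ inject₁)) + inv (x (fromℕ m))      ≡⟨ ℚ.+-comm (∑inv (descending (x ∘ inject₁))) _ ⟩
  inv (x (fromℕ m)) + ∑inv (descending (x ∘ inject₁))      ∎
  where open ≡-Reasoning

descending-injective : ∀ {m} (x : Fin m → ℕ) (a : ℕ → ℕ) →
  descending x ≡ applyDownFrom a m → ∀ i → x i ≡ a (toℕ i)
descending-injective {suc m} x a eq i with view i
... | ‵fromℕ     = trans (proj₁ (∷-injective eq)) (cong a (sym (toℕ-fromℕ m)))
... | ‵inject₁ j = trans (descending-injective (x ∘ inject₁) a (proj₂ (∷-injective eq)) j)
                         (cong a (sym (toℕ-inject₁ j)))

opposite-mono : ∀ {m} {i j : Fin m} → i Fin.< j → opposite j Fin.≤ opposite i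
opposite-mono {m} {i} {j} i<j = subst₂ ℕ._≤_ (sym (opposite-prop j)) (sym (opposite-prop i))
  (ℕ.∸-monoʳ-≤ m (ℕ.s≤s (ℕ.<⇒≤ i<j)))

∑inv-↭ : ∀ {xs ys} → xs ↭ ys → ∑inv xs ≡ ∑inv ys
∑inv-↭ p = foldr-commMonoid ℚ.+-0-isCommutativeMonoid (↭⇒↭ₛ (map⁺ inv p))

-- From the comparison of lists to unique best underapproximations

greedyUniqueBest : ∀ θ .{{_ : Positive θ}} →
  (∀ xs → All NonZero xs → ∑inv xs < θ → ∑inv (applyDownFrom (𝒢 θ) (length xs)) ≤ ∑inv xs →
   product (applyDownFrom (𝒢 θ) (length xs)) ℕ.≤ product xs) →
  ∀ m → GreedyUniqueBest θ m
greedyUniqueBest θ product-≥ m = greedyBest , greedyUnique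
  where
  open Comparison (𝒢 θ) (𝒢-nonZero θ)

  greedySum≡ : greedySum θ m ≡ ∑inv (initial m)
  greedySum≡ = trans (sym (∑𝒢≡greedySum θ m)) (sym (∑inv-𝒢 θ m))

  greedyBest : GreedyBest θ m
  greedyBest x x≢0 ∑<θ = subst₂ _≤_ (sym ∑≡) (trans (cong (∑inv ∘ initial) length≡) (sym greedySum≡))
    (proj₁ (best product-≥ ys (All-resp-↭ (↭-sym ys↭) (tabulate⁺ (x≢0 ∘ opposite))) (sort-↗ (descending x))
      (subst (_< θ) ∑≡ ∑<θ)))
    where
    -- `GreedyBest` puts no order on `x`, whereas `best` expects a descending list; sorting leaves
    -- the sum and the length unchanged.
    ys = sort (descending x)
    ys↭ : ys ↭ descending x
    ys↭ = sort-↭ (descending x)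
    ∑≡ : ∑1/ x x≢0 ≡ ∑inv ys
    ∑≡ = trans (∑inv-descending x x≢0) (sym (∑inv-↭ ys↭))
    length≡ : length ys ≡ m
    length≡ = trans (↭-length ys↭) (length-tabulate (x ∘ opposite))

  greedyUnique : ∀ (x : Fin m → ℕ) (x≢0 : ∀ i → NonZero (x i)) →
    (∀ i j → i Fin.≤ j → x i ℕ.≤ x j) →
    greedySum θ m ≤ ∑1/ x x≢0 → ∑1/ x x≢0 < θ → ∀ i → x i ≡ 𝒢 θ (toℕ i)
  greedyUnique x x≢0 x↗ S≤∑ ∑<θ = descending-injective x (𝒢 θ) $
    subst (λ n → xs ≡ initial n) length≡ $
    proj₁ (proj₂ (best product-≥ xs (tabulate⁺ (x≢0 ∘ opposite)) xs↘ (subst (_< θ) ∑≡ ∑<θ))) $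
    subst₂ _≤_ (trans greedySum≡ (cong (∑inv ∘ initial) (sym length≡))) ∑≡ S≤∑
    where
    xs = descending x
    xs↘ : Linked ℕ._≥_ xs
    xs↘ = AllPairs⇒Linked (tabulate⁺-< (λ i<j → x↗ _ _ (opposite-mono i<j)))
    ∑≡ : ∑1/ x x≢0 ≡ ∑inv xs
    ∑≡ = ∑inv-descending x x≢0
    length≡ : length xs ≡ m
    length≡ = length-tabulate (x ∘ opposite)

theorem1p12 : ∀ (p q : ℕ) .{{_ : NonZero p}} .{{_ : NonZero q}} →
    p ℕ.< q → ¬ (2 ∣ q) → Υ[ p , q ]≡ 2 →
    ∀ (m : ℕ) .{{_ : NonZero m}} →
    GreedyUniqueBest (+ p / q) {{+/-positive p q}} m
theorem1p12 p q _ 2∤q (_ , divides k q+2≡kp , Υ-least) m =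
  greedyUniqueBest (+ p / q) {{θ>0}}
    (greedy-product-≤ (𝒢-isGreedy (+ p / q) {{θ>0}}) (ι-*-/ p q) (trans q+2≡kp (ℕ.*-comm k p)) 2≤p 2∤q) m
  where
  θ>0 : Positive (+ p / q)
  θ>0 = +/-positive p q
  2≤p : 2 ℕ.≤ p
  -- If p were 1, it would divide q + 1, against the minimality of 2 in the definition of Υ.
  2≤p = ℕ.≰⇒> λ p≤1 → ℕ.1+n≰n $ Υ-least 1 (ℕ.s≤s ℕ.z≤n) $
    subst (_∣ q ℕ.+ 1) (ℕ.≤-antisym (ℕ.>-nonZero⁻¹ p) p≤1) (1∣ (q ℕ.+ 1))
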